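{- Let $f:\mathbb{Z}^+\times\mathbb{Z}^+\to\mathbb{Z}^+$ be such that $f(\cdot,q)$ is concave for each $q\in\mathbb{Z}^+$. Then, for any $q\in\mathbb{Z}^+$, $$\sum_{n=1}^{\infty}\frac{1}{q^{f(n,q)}\,n!}$$ is irrational.
   Context: $\mathbb{Z}^+=\{1,2,3,\dots\}$. Here "$f(\cdot,q)$ is concave" means, in this paper's terminology, that $f(x+y,q)\ge f(x,q)+f(y,q)$ for all $x,y\in\mathbb{Z}^+$. -}

module Defs where

open import Data.Fin using (toℕ)
open import Data.Integer using (+_)
open import Data.Irrelevant using ([_])
open import Data.Nat as ℕ using (ℕ; zero; suc; NonZero; _!)
open import Data.Nat.Properties using (m*n≢0; m^n≢0; _!≢0)
open import Data.Product using (∃-syntax; _,_)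
open import Data.Rational using (ℚ; 0ℚ; _/_; _-_; _<_; ∣_∣)
open import Data.Rational.Properties using (+-0-monoid; +-inverseʳ)
open import Data.Refinement using (Refinement-syntax; _,_; value)
open import Relation.Binary.PropositionalEquality using (_≡_; cong; sym; subst)
open import Relation.Nullary using (¬_)

open import Algebra.Properties.Monoid.Sum +-0-monoid using (sum-syntax)

infixl 6 _+⁺_
infixl 7 _*⁺_
infixr 8 _^⁺_
infix  9 _!⁺
infix  4 _≥⁺_ _≃_

ℤ⁺ : Set
ℤ⁺ = [ n ∈ ℕ ∣ NonZero n ]

suc⁺ : ℕ → ℤ⁺
suc⁺ n = suc n , [ _ ]

private
  m+n≢0 : ∀ m n → .{{NonZero m}} → NonZero (m ℕ.+ n)
  m+n≢0 (suc _) _ = _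

_+⁺_ : ℤ⁺ → ℤ⁺ → ℤ⁺
(m , [ p ]) +⁺ (n , _) = (m ℕ.+ n) , [ m+n≢0 m n {{p}} ]

_*⁺_ : ℤ⁺ → ℤ⁺ → ℤ⁺
(m , [ p ]) *⁺ (n , [ q ]) = (m ℕ.* n) , [ m*n≢0 m n {{p}} {{q}} ]

_^⁺_ : ℤ⁺ → ℤ⁺ → ℤ⁺
(m , [ p ]) ^⁺ (n , _) = (m ℕ.^ n) , [ m^n≢0 m n {{p}} ]

_!⁺ : ℤ⁺ → ℤ⁺
(n , _) !⁺ = (n !) , [ n !≢0 ]

_≥⁺_ : ℤ⁺ → ℤ⁺ → Set
m ≥⁺ n = value m ℕ.≥ value n

1/⁺_ : ℤ⁺ → ℚ
1/⁺ (n , [ p ]) = (+ 1 / n) {{p}}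

-- Superadditivity, not concavity in the usual sense.
Concave : (ℤ⁺ → ℤ⁺) → Set
Concave g = ∀ x y → g (x +⁺ y) ≥⁺ g x +⁺ g y

IsCauchy : (ℕ → ℚ) → Set
IsCauchy s = ∀ ε → 0ℚ < ε → ∃[ N ] (∀ m n → m ℕ.≥ N → n ℕ.≥ N → ∣ s m - s n ∣ < ε)

-- Real numbers as Cauchy sequences of rationals, with _≃_ as their equality.
record ℝ : Set where
  constructor mkℝ
  field
    approx : ℕ → ℚ
    cauchy : IsCauchy approx

open ℝ public

_≃_ : ℝ → ℝ → Set
x ≃ y = ∀ ε → 0ℚ < ε → ∃[ N ] (∀ n → n ℕ.≥ N → ∣ approx x n - approx y n ∣ < ε)

fromℚ : ℚ → ℝ
fromℚ r = mkℝ (λ _ → r) λ ε 0<ε → 0 , λ _ _ _ _ → subst (_< ε) (0≡∣r-r∣) 0<ε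
  where
  0≡∣r-r∣ : 0ℚ ≡ ∣ r - r ∣
  0≡∣r-r∣ = sym (cong ∣_∣ (+-inverseʳ r))

Irrational : ℝ → Set
Irrational x = ¬ (∃[ r ] x ≃ fromℚ r)

-- a(1) + ⋯ + a(N)
partialSum : (ℤ⁺ → ℚ) → ℕ → ℚ
partialSum a N = ∑[ i < N ] a (suc⁺ (toℕ i))

Convergent : (ℤ⁺ → ℚ) → Set
Convergent a = IsCauchy (partialSum a)

-- The limit of a Cauchy sequence of rationals is the real number it represents.
∑∞ : (a : ℤ⁺ → ℚ) → Convergent a → ℝ
∑∞ a c = mkℝ (partialSum a) c

{-# OPTIONS --safe #-}
-- Only monotonicity of f(·,q) matters: it makes each denominator d(n) = q^f(n,q) n! divide the
-- next one, with quotient at least n + 1. So the partial sum s(n) has denominator d(n), and since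
-- s(n) + 1/(n d(n)) is nonincreasing in n, the limit r satisfies s(n) < r ≤ s(n) + 1/(n d(n)).
-- If r = p/b, then b d(n) (r - s(n)) is a positive integer that is at most b/n, which is absurd
-- for n > b.
module Submission where

open import Defs
open import Data.Product using (Σ-syntax)

open import Data.Fin using (toℕ)
open import Data.Fin.Properties using (toℕ-fromℕ; toℕ-inject₁)
open import Data.Integer as ℤ using (+_; -[1+_])
import Data.Integer.Properties as ℤ
import Data.Integer.Solver as ℤSolver
open import Data.Irrelevant using ([_])
open import Data.Nat as ℕ using (ℕ; zero; suc; s≤s; _!)
import Data.Nat.Properties as ℕ
import Data.Nat.Solver as ℕSolver
open import Data.Product using (∃-syntax; _,_)
open import Data.Rational using (ℚ; mkℚ; 0ℚ; _/_; _+_; _-_; -_; _≤_; _<_; *≤*; ∣_∣; toℚᵘ)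
open import Data.Rational.Properties as ℚ using (+-0-monoid)
import Data.Rational.Solver as ℚSolver
open import Data.Rational.Unnormalised as ℚᵘ using (mkℚᵘ)
import Data.Rational.Unnormalised.Properties as ℚᵘ
open import Data.Refinement using (_,_; value)
open import Data.Sum using (inj₁; inj₂)
open import Function using (_∘_)
open import Relation.Binary.Core using (Rel)
open import Relation.Binary.Definitions using (Reflexive; Transitive)
open import Relation.Binary.PropositionalEquality
  using (_≡_; refl; sym; trans; cong; cong₂; subst; subst₂; module ≡-Reasoning)
open import Relation.Nullary using (¬_)

open import Algebra.Properties.Monoid.Sum +-0-monoid using (sum-init-last; sum-cong-≗)

-- The relation is arbitrary so that one induction serves both the nondecreasing `s` and, with the
-- order reversed, the nonincreasing `u`.
stepwise⇒monotone : ∀ {a ℓ} {A : Set a} {_∼_ : Rel A ℓ} → Reflexive _∼_ → Transitive _∼_ →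
  (g : ℕ → A) → (∀ n → g n ∼ g (suc n)) → ∀ {m n} → m ℕ.≤ n → g m ∼ g n
stepwise⇒monotone {_∼_ = _∼_} r t g step m≤n = go (ℕ.≤⇒≤′ m≤n)
  where
  go : ∀ {m n} → m ℕ.≤′ n → g m ∼ g n
  go (ℕ.≤′-reflexive refl) = r
  go (ℕ.≤′-step m≤′n)      = t (go m≤′n) (step _)

<⇒≱ : ∀ {p q} → p < q → ¬ q ≤ p
<⇒≱ p<q q≤p = ℚ.<-irrefl refl (ℚ.<-≤-trans p<q q≤p)

-- Fractions of natural numbers

infixl 7 _÷_

_÷_ : ℕ → ℤ⁺ → ℚ
m ÷ (n , [ p ]) = (+ m / n) {{p}}

-- Since `_/_` reduces to lowest terms, cross-multiplication is done on unnormalised rationals,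
-- where `m` and `n` stay visible.
toℚᵘ-÷ : ∀ m n → toℚᵘ (m ÷ suc⁺ n) ℚᵘ.≃ mkℚᵘ (+ m) n
toℚᵘ-÷ m n = ℚ.toℚᵘ-fromℚᵘ (mkℚᵘ (+ m) n)

÷-mono-≤ : ∀ m k d e → m ℕ.* value e ℕ.≤ k ℕ.* value d → m ÷ d ≤ k ÷ e
÷-mono-≤ m k (suc d , _) (suc e , _) me≤kd = ℚ.toℚᵘ-cancel-≤ (begin
  toℚᵘ (m ÷ suc⁺ d) ≃⟨ toℚᵘ-÷ m d ⟩
  mkℚᵘ (+ m) d      ≤⟨ ℚᵘ.*≤* (subst₂ ℤ._≤_ (ℤ.pos-* m (suc e)) (ℤ.pos-* k (suc d)) (ℤ.+≤+ me≤kd)) ⟩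
  mkℚᵘ (+ k) e      ≃⟨ toℚᵘ-÷ k e ⟨
  toℚᵘ (k ÷ suc⁺ e) ∎)
  where open ℚᵘ.≤-Reasoning

÷-mono-< : ∀ m k d e → m ℕ.* value e ℕ.< k ℕ.* value d → m ÷ d < k ÷ e
÷-mono-< m k (suc d , _) (suc e , _) me<kd = ℚ.toℚᵘ-cancel-< (begin-strict
  toℚᵘ (m ÷ suc⁺ d) ≃⟨ toℚᵘ-÷ m d ⟩
  mkℚᵘ (+ m) d      <⟨ ℚᵘ.*<* (subst₂ ℤ._<_ (ℤ.pos-* m (suc e)) (ℤ.pos-* k (suc d)) (ℤ.+<+ me<kd)) ⟩
  mkℚᵘ (+ k) e      ≃⟨ toℚᵘ-÷ k e ⟨
  toℚᵘ (k ÷ suc⁺ e) ∎)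
  where open ℚᵘ.≤-Reasoning

÷-cancel-≤ : ∀ m k d e → m ÷ d ≤ k ÷ e → m ℕ.* value e ℕ.≤ k ℕ.* value d
÷-cancel-≤ m k d e p = ℕ.≮⇒≥ λ kd<me → <⇒≱ (÷-mono-< k m e d kd<me) p

÷-cancel-< : ∀ m k d e → m ÷ d < k ÷ e → m ℕ.* value e ℕ.< k ℕ.* value d
÷-cancel-< m k d e p = ℕ.≰⇒> λ kd≤me → <⇒≱ p (÷-mono-≤ k m e d kd≤me)

-- As `e` is a multiple of `d`, it serves as common denominator, and the numerator stays an explicit
-- natural number.
÷-+-1÷ : ∀ m d e c → value e ≡ value d ℕ.* c → m ÷ d + 1 ÷ e ≡ (m ℕ.* c ℕ.+ 1) ÷ e
÷-+-1÷ m (suc d , _) (suc e , _) c e≡dc = ℚ.toℚᵘ-injective (begin-equality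
  toℚᵘ (m ÷ suc⁺ d + 1 ÷ suc⁺ e)              ≃⟨ ℚ.toℚᵘ-homo-+ (m ÷ suc⁺ d) (1 ÷ suc⁺ e) ⟩
  toℚᵘ (m ÷ suc⁺ d) ℚᵘ.+ toℚᵘ (1 ÷ suc⁺ e)    ≃⟨ ℚᵘ.+-cong (toℚᵘ-÷ m d) (toℚᵘ-÷ 1 e) ⟩
  mkℚᵘ (+ m) d ℚᵘ.+ mkℚᵘ (+ 1) e              ≃⟨ ℚᵘ.*≡* numerators ⟩
  mkℚᵘ (+ (m ℕ.* c ℕ.+ 1)) e                  ≃⟨ toℚᵘ-÷ (m ℕ.* c ℕ.+ 1) e ⟨
  toℚᵘ ((m ℕ.* c ℕ.+ 1) ÷ suc⁺ e)             ∎)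
  where
  open ℚᵘ.≤-Reasoning
  open ℤSolver.+-*-Solver
  D E : ℤ.ℤ
  D = + suc d
  E = + suc e
  E≡Dc : E ≡ D ℤ.* + c
  E≡Dc = trans (cong +_ e≡dc) (ℤ.pos-* (suc d) c)
  numerators : (+ m ℤ.* E ℤ.+ + 1 ℤ.* D) ℤ.* E ≡ + (m ℕ.* c ℕ.+ 1) ℤ.* (D ℤ.* E)
  numerators = trans
    (trans (cong (λ x → (+ m ℤ.* x ℤ.+ + 1 ℤ.* D) ℤ.* E) E≡Dc)
      (solve 4 (λ m d c e → (m :* (d :* c) :+ con (+ 1) :* d) :* e := (m :* c :+ con (+ 1)) :* (d :* e))
        refl (+ m) D (+ c) E))
    (cong (ℤ._* (D ℤ.* E)) (sym (trans (ℤ.pos-+ (m ℕ.* c) 1) (cong (ℤ._+ + 1) (ℤ.pos-* m c)))))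

nonNegative⇒÷ : ∀ {r} → 0ℚ ≤ r → ∃[ p ] ∃[ b ] r ≡ p ÷ suc⁺ b
nonNegative⇒÷ {mkℚ (+ p) b c} _ = p , b , sym (ℚ.↥p/↧p≡p (mkℚ (+ p) b c))
nonNegative⇒÷ {mkℚ -[1+ _ ] _ _} (*≤* ())

0≤÷ : ∀ m d → 0ℚ ≤ m ÷ d
0≤÷ m d = ÷-mono-≤ 0 m (suc⁺ 0) d ℕ.z≤n

-- Distances and limits of rationals

neg-minus : ∀ x y → - (x - y) ≡ y - x
neg-minus = solve 2 (λ x y → :- (x :- y) := y :- x) refl
  where open ℚSolver.+-*-Solver

p≤∣p∣ : ∀ p → p ≤ ∣ p ∣
p≤∣p∣ p with ℚ.≤-total 0ℚ p
... | inj₁ 0≤p = ℚ.≤-reflexive (sym (ℚ.0≤p⇒∣p∣≡p 0≤p))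
... | inj₂ p≤0 = ℚ.≤-trans p≤0 (ℚ.0≤∣p∣ p)

∣minus∣-comm : ∀ x y → ∣ x - y ∣ ≡ ∣ y - x ∣
∣minus∣-comm x y = trans (sym (ℚ.∣-p∣≡∣p∣ (x - y))) (cong ∣_∣ (neg-minus x y))

minus-mono-≤ : ∀ {x x′ y y′} → x ≤ x′ → y′ ≤ y → x - y ≤ x′ - y′
minus-mono-≤ x≤x′ y′≤y = ℚ.+-mono-≤ x≤x′ (ℚ.neg-antimono-≤ y′≤y)

interval-distance : ∀ {l u x y} → l ≤ x → x ≤ u → l ≤ y → y ≤ u → ∣ x - y ∣ ≤ u - l
interval-distance {l} {u} {x} {y} l≤x x≤u l≤y y≤u with ℚ.∣p∣≡p∨∣p∣≡-p (x - y)
... | inj₁ eq = subst (_≤ u - l) (sym eq) (minus-mono-≤ x≤u l≤y)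
... | inj₂ eq = subst (_≤ u - l) (sym (trans eq (neg-minus x y))) (minus-mono-≤ y≤u l≤x)

p<q⇒0<q-p : ∀ {p q} → p < q → 0ℚ < q - p
p<q⇒0<q-p {p} {q} p<q = subst (_< q - p) (ℚ.+-inverseʳ p) (ℚ.+-monoˡ-< (- p) p<q)

-- If r < l, closeness within l - r at an index beyond both thresholds would force `approx x n`
-- below l.
limit-lower : ∀ x r l → x ≃ fromℚ r → ∀ M → (∀ n → n ℕ.≥ M → l ≤ approx x n) → l ≤ r
limit-lower x r l x≃r M l≤x = ℚ.≮⇒≥ λ r<l →
  let N , close = x≃r (l - r) (p<q⇒0<q-p r<l)
      n         = M ℕ.⊔ N
  in <⇒≱ (close n (ℕ.m≤n⊔m M N))
       (ℚ.≤-trans (minus-mono-≤ (l≤x n (ℕ.m≤m⊔n M N)) (ℚ.≤-refl {r})) (p≤∣p∣ _))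

limit-upper : ∀ x r u → x ≃ fromℚ r → ∀ M → (∀ n → n ℕ.≥ M → approx x n ≤ u) → r ≤ u
limit-upper x r u x≃r M x≤u = ℚ.≮⇒≥ λ u<r →
  let N , close = x≃r (r - u) (p<q⇒0<q-p u<r)
      n         = M ℕ.⊔ N
  in <⇒≱ (subst (_< r - u) (∣minus∣-comm (approx x n) r) (close n (ℕ.m≤n⊔m M N)))
       (ℚ.≤-trans (minus-mono-≤ (ℚ.≤-refl {r}) (x≤u n (ℕ.m≤m⊔n M N))) (p≤∣p∣ _))

partialSum-suc : ∀ a n → partialSum a (suc n) ≡ partialSum a n + a (suc⁺ n)
partialSum-suc a n = trans (sum-init-last {n} (λ i → a (suc⁺ (toℕ i)))) (cong₂ _+_
  (sum-cong-≗ {n} (λ i → cong (a ∘ suc⁺) (toℕ-inject₁ i)))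
  (cong (a ∘ suc⁺) (toℕ-fromℕ n)))

-- Sums of reciprocals of a divisibility chain with growing quotients

module _
  (d : ℤ⁺ → ℤ⁺)
  (c : ℕ → ℕ)
  (d-step : ∀ n → value (d (suc⁺ (suc n))) ≡ value (d (suc⁺ n)) ℕ.* c n)
  (c-growth : ∀ n → suc (suc n) ℕ.≤ c n)
  where

  private
    -- D, A and u are indexed from 0, so index n goes with the partial sum of n + 1 terms.
    D : ℕ → ℤ⁺
    D n = d (suc⁺ n)

    s : ℕ → ℚ
    s = partialSum (λ n → 1/⁺ d n)

    A : ℕ → ℕ
    A zero    = 1
    A (suc n) = A n ℕ.* c n ℕ.+ 1

    -- With k = n + 1, all later quotients are at least k + 1, so the terms after the k-th sum to at
    -- most the geometric series of ratio 1/(k+1), which is 1/k, divided by `D n`.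
    tailDenominator : ℕ → ℤ⁺
    tailDenominator n = D n *⁺ suc⁺ n

    u : ℕ → ℚ
    u n = s (suc n) + 1 ÷ tailDenominator n

    s-suc : ∀ n → s (suc n) ≡ s n + 1 ÷ D n
    s-suc = partialSum-suc (λ n → 1/⁺ d n)

    s≡A÷D : ∀ n → s (suc n) ≡ A n ÷ D n
    s≡A÷D zero    = ℚ.+-identityʳ _
    s≡A÷D (suc n) = trans (s-suc (suc n))
      (trans (cong (_+ 1 ÷ D (suc n)) (s≡A÷D n)) (÷-+-1÷ (A n) (D n) (D (suc n)) (c n) (d-step n)))

    u≡÷ : ∀ n → u n ≡ (A n ℕ.* suc n ℕ.+ 1) ÷ tailDenominator n
    u≡÷ n = trans (cong (_+ 1 ÷ tailDenominator n) (s≡A÷D n))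
      (÷-+-1÷ (A n) (D n) (tailDenominator n) (suc n) refl)

    p≤p+m÷ : ∀ p m e → p ≤ p + m ÷ e
    p≤p+m÷ p m e = subst (_≤ p + m ÷ e) (ℚ.+-identityʳ p) (ℚ.+-monoʳ-≤ p (0≤÷ m e))

    s-mono : ∀ {m n} → m ℕ.≤ n → s m ≤ s n
    s-mono = stepwise⇒monotone {_∼_ = _≤_} ℚ.≤-refl ℚ.≤-trans s
      λ n → subst (s n ≤_) (sym (s-suc n)) (p≤p+m÷ (s n) 1 (D n))

    -- Put k = n + 1. Cross-multiplying and removing the common part leaves k(k+2) ≤ (k+1) `c n`,
    -- which holds because k(k+2) < (k+1)² and `c n` is at least k + 1.
    u-step : ∀ n → u (suc n) ≤ u n
    u-step n = subst₂ _≤_ (sym (u≡÷ (suc n))) (sym (u≡÷ n))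
      (÷-mono-≤ (A (suc n) ℕ.* suc (suc n) ℕ.+ 1) (a ℕ.* suc n ℕ.+ 1) (tailDenominator (suc n)) (tailDenominator n) cross)
      where
      open ℕ.≤-Reasoning
      open ℕSolver.+-*-Solver
      a = A n
      δ = value (D n)
      q = c n
      common = δ ℕ.* (suc n ℕ.* suc (suc n) ℕ.* (a ℕ.* q))
      square : suc n ℕ.* (3 ℕ.+ n) ℕ.≤ suc (suc n) ℕ.* q
      square = begin
        suc n ℕ.* (3 ℕ.+ n)          ≤⟨ ℕ.m≤m+n _ 1 ⟩
        suc n ℕ.* (3 ℕ.+ n) ℕ.+ 1    ≡⟨ solve 1 (λ n → (con 1 :+ n) :* (con 3 :+ n) :+ con 1 := (con 2 :+ n) :* (con 2 :+ n)) refl n ⟩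
        suc (suc n) ℕ.* suc (suc n)  ≤⟨ ℕ.*-monoʳ-≤ (suc (suc n)) (c-growth n) ⟩
        suc (suc n) ℕ.* q            ∎
      cross : (A (suc n) ℕ.* suc (suc n) ℕ.+ 1) ℕ.* (δ ℕ.* suc n)
        ℕ.≤ (a ℕ.* suc n ℕ.+ 1) ℕ.* (value (D (suc n)) ℕ.* suc (suc n))
      cross = begin
        ((a ℕ.* q ℕ.+ 1) ℕ.* suc (suc n) ℕ.+ 1) ℕ.* (δ ℕ.* suc n)
          ≡⟨ solve 4 (λ n a δ q →
               ((a :* q :+ con 1) :* (con 2 :+ n) :+ con 1) :* (δ :* (con 1 :+ n)) :=
               δ :* ((con 1 :+ n) :* (con 2 :+ n) :* (a :* q)) :+ δ :* ((con 1 :+ n) :* (con 3 :+ n)))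
               refl n a δ q ⟩
        common ℕ.+ δ ℕ.* (suc n ℕ.* (3 ℕ.+ n))
          ≤⟨ ℕ.+-monoʳ-≤ common (ℕ.*-monoʳ-≤ δ square) ⟩
        common ℕ.+ δ ℕ.* (suc (suc n) ℕ.* q)
          ≡⟨ solve 4 (λ n a δ q →
               δ :* ((con 1 :+ n) :* (con 2 :+ n) :* (a :* q)) :+ δ :* ((con 2 :+ n) :* q) :=
               (a :* (con 1 :+ n) :+ con 1) :* ((δ :* q) :* (con 2 :+ n)))
               refl n a δ q ⟩
        (a ℕ.* suc n ℕ.+ 1) ℕ.* ((δ ℕ.* q) ℕ.* suc (suc n))
          ≡⟨ cong (λ x → (a ℕ.* suc n ℕ.+ 1) ℕ.* (x ℕ.* suc (suc n))) (d-step n) ⟨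
        (a ℕ.* suc n ℕ.+ 1) ℕ.* (value (D (suc n)) ℕ.* suc (suc n)) ∎

    -- Chains `s (suc k) ≤ u k ≤ u n`.
    s≤u : ∀ {n k} → suc n ℕ.≤ k → s k ≤ u n
    s≤u {n} {suc k} (s≤s n≤k) = ℚ.≤-trans (p≤p+m÷ (s (suc k)) 1 (tailDenominator k))
      (stepwise⇒monotone {_∼_ = λ x y → y ≤ x} ℚ.≤-refl (λ p q → ℚ.≤-trans q p) u u-step n≤k)

    tailDenominator-large : ∀ n → suc n ℕ.≤ value (tailDenominator n)
    tailDenominator-large n with D n
    ... | suc δ , _ = ℕ.m≤m+n (suc n) _

  reciprocals-convergent : Convergent (λ n → 1/⁺ d n)
  reciprocals-convergent ε 0<ε with nonNegative⇒÷ (ℚ.<⇒≤ 0<ε)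
  -- Here ε = p/(b+1). All partial sums with at least b + 2 terms lie in an interval of width t ≤
  -- 1/(b+2) < 1/(b+1) ≤ ε.
  ... | p , b , refl = suc (suc b) , λ m n m≥N n≥N → ℚ.≤-<-trans
    (interval-distance (s-mono m≥N) (s≤u m≥N) (s-mono n≥N) (s≤u n≥N))
    (subst (_< p ÷ suc⁺ b) (sym u-s) small)
    where
    t = 1 ÷ tailDenominator (suc b)
    u-s : u (suc b) - s (suc (suc b)) ≡ t
    u-s = solve 2 (λ x y → (x :+ y) :- x := y) refl (s (suc (suc b))) t
      where open ℚSolver.+-*-Solver
    0<p : 0 ℕ.< p
    0<p = subst (0 ℕ.<_) (ℕ.*-identityʳ p) (÷-cancel-< 0 p (suc⁺ 0) (suc⁺ b) 0<ε)
    small : t < p ÷ suc⁺ b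
    small = ÷-mono-< 1 p (tailDenominator (suc b)) (suc⁺ b) (begin-strict
      1 ℕ.* suc b                        ≡⟨ ℕ.*-identityˡ (suc b) ⟩
      suc b                              <⟨ tailDenominator-large (suc b) ⟩
      value (tailDenominator (suc b))          ≡⟨ ℕ.*-identityˡ _ ⟨
      1 ℕ.* value (tailDenominator (suc b))    ≤⟨ ℕ.*-monoˡ-≤ _ 0<p ⟩
      p ℕ.* value (tailDenominator (suc b))    ∎)
      where open ℕ.≤-Reasoning

  private
    S : ℝ
    S = ∑∞ (λ n → 1/⁺ d n) reciprocals-convergent

    -- The integer x = pδ - ab satisfies x ≥ 1 by `below` and xN ≤ b by `above`, so N ≤ b, although
    -- N = b + 1.
    ¬limit-÷ : ∀ p b′ → ¬ S ≃ fromℚ (p ÷ suc⁺ b′)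
    ¬limit-÷ p b′ s→r = ℕ.<⇒≱ (ℕ.n<1+n b) (ℕ.+-cancelˡ-≤ (a ℕ.* N ℕ.* b) N b (begin
      a ℕ.* N ℕ.* b ℕ.+ N     ≡⟨ solve 3 (λ a b N → a :* N :* b :+ N := (con 1 :+ a :* b) :* N) refl a b N ⟩
      suc (a ℕ.* b) ℕ.* N     ≤⟨ ℕ.*-monoˡ-≤ N below ⟩
      p ℕ.* δ ℕ.* N           ≡⟨ ℕ.*-assoc p δ N ⟩
      p ℕ.* (δ ℕ.* N)         ≤⟨ above ⟩
      (a ℕ.* N ℕ.+ 1) ℕ.* b   ≡⟨ solve 3 (λ a b N → (a :* N :+ con 1) :* b := a :* N :* b :+ b) refl a b N ⟩
      a ℕ.* N ℕ.* b ℕ.+ b     ∎))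
      where
      open ℕ.≤-Reasoning
      open ℕSolver.+-*-Solver
      b = suc b′
      -- Index b goes with N terms, so the tail bound in `u b` is 1/(δN), and N just exceeds the
      -- denominator b.
      N = suc b
      a = A b
      δ = value (D b)
      q = c b
      above : p ℕ.* (δ ℕ.* N) ℕ.≤ (a ℕ.* N ℕ.+ 1) ℕ.* b
      above = ÷-cancel-≤ p (a ℕ.* N ℕ.+ 1) (suc⁺ b′) (tailDenominator b)
        (subst (p ÷ suc⁺ b′ ≤_) (u≡÷ b) (limit-upper S (p ÷ suc⁺ b′) (u b) s→r N λ n N≤n → s≤u N≤n))
      -- Limits preserve only weak inequalities. The strict bound in `below` comes from comparing
      -- the limit with one further partial sum, whose extra term is positive.
      next : A (suc b) ℕ.* b ℕ.≤ p ℕ.* value (D (suc b))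
      next = ÷-cancel-≤ (A (suc b)) p (D (suc b)) (suc⁺ b′)
        (subst (_≤ p ÷ suc⁺ b′) (s≡A÷D (suc b)) (limit-lower S (p ÷ suc⁺ b′) (s (suc N)) s→r (suc N) λ n → s-mono))
      below : a ℕ.* b ℕ.< p ℕ.* δ
      below = ℕ.*-cancelʳ-< q (a ℕ.* b) (p ℕ.* δ) (begin-strict
        a ℕ.* b ℕ.* q             <⟨ ℕ.m<m+n _ (s≤s ℕ.z≤n) ⟩
        a ℕ.* b ℕ.* q ℕ.+ b       ≡⟨ solve 3 (λ a b q → a :* b :* q :+ b := (a :* q :+ con 1) :* b) refl a b q ⟩
        (a ℕ.* q ℕ.+ 1) ℕ.* b     ≤⟨ next ⟩
        p ℕ.* value (D (suc b))   ≡⟨ cong (p ℕ.*_) (d-step b) ⟩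
        p ℕ.* (δ ℕ.* q)           ≡⟨ ℕ.*-assoc p δ q ⟨
        p ℕ.* δ ℕ.* q             ∎)

  reciprocals-irrational : Irrational S
  reciprocals-irrational (r , s→r) =
    -- The empty sum `s 0` is 0, so the limit is nonnegative and has a natural numerator.
    let p , b , r≡p÷b = nonNegative⇒÷ {r} (limit-lower S r 0ℚ s→r 0 λ n _ → s-mono {0} {n} ℕ.z≤n)
    in ¬limit-÷ p b (subst (λ x → S ≃ fromℚ x) r≡p÷b s→r)

-- Application to the denominators q^f(n,q) n!

-- Split n + 2 as 1 + (n + 1) and drop the summand `g (suc⁺ 0)`.
concave-increasing : ∀ g → Concave g → ∀ n → value (g (suc⁺ n)) ℕ.≤ value (g (suc⁺ (suc n)))
concave-increasing g concave n = ℕ.≤-trans (ℕ.m≤n+m _ _) (concave (suc⁺ 0) (suc⁺ n))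

corollary61 : (f : ℤ⁺ → ℤ⁺ → ℤ⁺) →
    (∀ q → Concave (λ x → f x q)) →
    ∀ q → let a = λ n → 1/⁺ ((q ^⁺ f n q) *⁺ (n !⁺)) in
    Σ[ c ∈ Convergent a ] Irrational (∑∞ a c)
corollary61 f concave q@(Q , [ Q≢0 ]) =
  reciprocals-convergent d c d-step c-growth , reciprocals-irrational d c d-step c-growth
  where
  d : ℤ⁺ → ℤ⁺
  d n = (q ^⁺ f n q) *⁺ (n !⁺)
  g : ℕ → ℕ
  g n = value (f (suc⁺ n) q)
  c : ℕ → ℕ
  -- The truncated subtraction is exact by `concave-increasing`. The factor n + 2 is the ratio of
  -- (n+2)! to (n+1)!, as `g` is indexed from 0.
  c n = Q ℕ.^ (g (suc n) ℕ.∸ g n) ℕ.* suc (suc n)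
  c-growth : ∀ n → suc (suc n) ℕ.≤ c n
  c-growth n = ℕ.m≤n*m (suc (suc n)) _ {{ℕ.m^n≢0 Q (g (suc n) ℕ.∸ g n) {{Q≢0}}}}
  d-step : ∀ n → value (d (suc⁺ (suc n))) ≡ value (d (suc⁺ n)) ℕ.* c n
  d-step n = begin
    Q ℕ.^ g (suc n) ℕ.* (suc (suc n) ℕ.* k)
      ≡⟨ cong (λ e → Q ℕ.^ e ℕ.* (suc (suc n) ℕ.* k)) (ℕ.m+[n∸m]≡n (concave-increasing (λ x → f x q) (concave q) n)) ⟨
    Q ℕ.^ (g n ℕ.+ e) ℕ.* (suc (suc n) ℕ.* k)
      ≡⟨ cong (ℕ._* (suc (suc n) ℕ.* k)) (ℕ.^-distribˡ-+-* Q (g n) e) ⟩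
    Q ℕ.^ g n ℕ.* Q ℕ.^ e ℕ.* (suc (suc n) ℕ.* k)
      ≡⟨ solve 4 (λ x y m k → x :* y :* (m :* k) := x :* k :* (y :* m)) refl (Q ℕ.^ g n) (Q ℕ.^ e) (suc (suc n)) k ⟩
    Q ℕ.^ g n ℕ.* k ℕ.* c n ∎
    where
    open ≡-Reasoning
    open ℕSolver.+-*-Solver
    k = suc n !
    e = g (suc n) ℕ.∸ g n
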